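{- If $G$ is a connected $n$-vertex graph that is not a triangle (i.e. $G$ is not isomorphic to $K_3$), then $$\iota_{\rm c}(G) \leq \frac{n}{4}.$$ Consequently, for any integer $n \geq 1$, $$\iota_{\rm c}(n) = \iota_{\rm c}(B_{n,K_3}) = \left\lfloor \frac{n}{4} \right\rfloor.$$
   Context: All graphs are finite and simple. An $n$-vertex graph is a graph with exactly $n$ vertices. For a graph $G$ and $v \in V(G)$, $N[v]$ is the set consisting of $v$ and its neighbours; for $D \subseteq V(G)$, $N[D] = \bigcup_{v \in D} N[v]$, and $G - N[D]$ is the subgraph of $G$ induced by $V(G) \setminus N[D]$. A set $D \subseteq V(G)$ is a cycle isolating set of $G$ if $G - N[D]$ contains no cycle (of any length $\geq 3$), i.e. is a forest (the graph with no vertices counts as a forest). $\iota_{\rm c}(G)$ denotes the size of a smallest cycle isolating set of $G$. For an integer $n \geq 1$, $[n] = \{1,\dots,n\}$, and $\iota_{\rm c}(n)$ denotes the maximum of $\iota_{\rm c}(G)$ over all connected graphs $G$ with $V(G) = [n]$ and $G \not\simeq K_3$. $P_m$ denotes the path with vertex set $[m]$ and edges $\{i,i+1\}$, $1 \le i \le m-1$. The graph $B_{n,K_3}$ is defined as follows. If $n \leq 3$, then $B_{n,K_3} = P_n$. If $n \geq 4$, let $a = \lfloor n/4 \rfloor$ and $b = n - 3a$ (so $a \le b \le a+3$). Let $P^*$ be the graph with vertex set $[b]$ and edge set $E(P_a) \cup \{\{a,i\} \colon i \in [b] \setminus [a]\}$. Take copies $F_1, \dots, F_a$ of $K_3$ that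 are vertex-disjoint from each other and from $P^*$. Then $B_{n,K_3}$ is the connected $n$-vertex graph obtained from the union of $P^*, F_1, \dots, F_a$ by joining, for each $i \in [a]$, the vertex $i$ of $P^*$ to every vertex of $F_i$. -}

module Defs where

open import Data.Bool.Base using (if_then_else_)
open import Data.Fin.Base using (Fin; zero; suc; toℕ; inject₁; fromℕ)
open import Data.Fin.Permutation using (cast-id)
open import Data.Fin.Properties as Fin using (any?; all?; +↔⊎; *↔×; injective⇒≤)
open import Data.Fin.Subset using (Subset; _∈_; ∁; ⊤; ∣_∣)
open import Data.Fin.Subset.Properties using (_∈?_; anySubset?; ∈⊤; x∈∁p⇒x∉p)
open import Data.Nat.Base
open import Data.Nat.DivMod using (_/_; m/n*n≤m)
open import Data.Nat.Properties as ℕ using (_≤?_; _<?_; anyUpTo?)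
open import Data.Product.Base using (Σ; ∃; _×_; _,_; proj₁; proj₂)
open import Data.Sum.Base using (_⊎_; inj₁; inj₂; swap)
open import Data.Sum.Function.Propositional using (_⊎-↔_)
open import Data.Vec.Base using (Vec; []; _∷_; tabulate; lookup)
open import Data.Vec.Properties using (lookup∘tabulate; lookup⇒[]=)
open import Data.Vec.Properties.WithK using ([]=-irrelevant)
open import Function.Base using (_∘_)
open import Function.Bundles using (_↔_; _⇔_; Inverse)
open import Function.Construct.Composition using (_↔-∘_)
open import Function.Construct.Identity using (↔-id)
open import Function.Definitions using (Injective)
open import Relation.Binary.Construct.Closure.ReflexiveTransitive using (Star)
open import Relation.Binary.Definitions using (DecidableEquality)
open import Relation.Binary.PropositionalEquality
open import Relation.Nullary using (¬_; Dec; yes; no; does; contradiction)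
open import Relation.Nullary.Decidable
  using (map′; dec-true; ¬?; _×-dec_; _⊎-dec_; _→-dec_)
open import Relation.Unary using (Decidable)

record Graph (V : Set) : Set₁ where
  field
    Adj        : V → V → Set
    adj?       : ∀ u v → Dec (Adj u v)
    adj-sym    : ∀ {u v} → Adj u v → Adj v u
    adj-irrefl : ∀ {v} → ¬ Adj v v

open Graph public

record _≅_ {V W : Set} (G : Graph V) (H : Graph W) : Set where
  field
    bijection : V ↔ W
    adjacency : ∀ u v →
      Adj G u v ⇔ Adj H (Inverse.to bijection u) (Inverse.to bijection v)

Connected : {V : Set} → Graph V → Set
Connected G = ∀ u v → Star (Adj G) u v

-- c lists the vertices of a cycle of length m + 3 in order.
IsCycle : {V : Set} (G : Graph V) (m : ℕ) → (Fin (3 + m) → V) → Set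
IsCycle G m c = Injective _≡_ _≡_ c
              × (∀ i → Adj G (c (inject₁ i)) (c (suc i)))
              × Adj G (c (fromℕ (2 + m))) (c zero)

HasCycle : {V : Set} → Graph V → Set
HasCycle G = ∃ λ m → ∃ λ c → IsCycle G m c

relabel : {V W : Set} → W ↔ V → Graph V → Graph W
relabel f G = record
  { Adj        = λ u v → Adj G (to u) (to v)
  ; adj?       = λ u v → adj? G (to u) (to v)
  ; adj-sym    = adj-sym G
  ; adj-irrefl = adj-irrefl G
  }
  where open Inverse f using (to)

-- Membership in a Subset is proof-irrelevant, so ∃ (_∈ S) really has one
-- vertex for each element of S.
induced : ∀ {n} → Graph (Fin n) → (S : Subset n) → Graph (∃ (_∈ S))
induced G S = record
  { Adj        = λ u v → Adj G (proj₁ u) (proj₁ v)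
  ; adj?       = λ u v → adj? G (proj₁ u) (proj₁ v)
  ; adj-sym    = adj-sym G
  ; adj-irrefl = adj-irrefl G
  }

N[_] : ∀ {n} → Graph (Fin n) → Fin n → Subset n
N[ G ] v = tabulate λ u → does ((u Fin.≟ v) ⊎-dec adj? G v u)

N[_]ˢ : ∀ {n} → Graph (Fin n) → Subset n → Subset n
N[ G ]ˢ D = tabulate λ u → does (any? λ v → (v ∈? D) ×-dec (u ∈? N[ G ] v))

CycleIsolating : ∀ {n} → Graph (Fin n) → Subset n → Set
CycleIsolating G D = ¬ HasCycle (induced G (∁ (N[ G ]ˢ D)))

IsMinimum IsMaximum : ∀ {ℓ} → (ℕ → Set ℓ) → ℕ → Set ℓ
IsMinimum P m = P m × (∀ k → P k → m ≤ k)
IsMaximum P m = P m × (∀ k → P k → k ≤ m)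

IsolatingSize : ∀ {n} → Graph (Fin n) → ℕ → Set
IsolatingSize G k = ∃ λ D → CycleIsolating G D × ∣ D ∣ ≡ k

Searchable : Set → Set₁
Searchable A = {P : A → Set} → Decidable P → Dec (∃ P)

searchVec : ∀ {A} → Searchable A → ∀ k → Searchable (Vec A k)
searchVec s zero    P? = map′ ([] ,_) (λ { ([] , p) → p }) (P? [])
searchVec s (suc k) P? =
  map′ (λ { (x , xs , p) → x ∷ xs , p }) (λ { (x ∷ xs , p) → x , xs , p })
    (s λ x → searchVec s k λ xs → P? (x ∷ xs))

searchSubset : ∀ {n} (S : Subset n) → Searchable (∃ (_∈ S))
searchSubset S {P} P? =
  map′ (λ { (x , p , q) → (x , p) , q }) (λ { ((x , p) , q) → x , p , q })
    (any? dec)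
  where
  dec : ∀ x → Dec (Σ (x ∈ S) λ p → P (x , p))
  dec x with x ∈? S
  ... | no x∉S = no (x∉S ∘ proj₁)
  ... | yes p  = map′ (p ,_)
    (λ { (p′ , q) → subst (λ r → P (x , r)) ([]=-irrelevant p′ p) q })
    (P? (x , p))

proj₁-inj : ∀ {n} {S : Subset n} {u v : ∃ (_∈ S)} → proj₁ u ≡ proj₁ v → u ≡ v
proj₁-inj {u = _ , p} {_ , q} refl = cong (_ ,_) ([]=-irrelevant p q)

cong-IsCycle : ∀ {V} (G : Graph V) m {c d} → (∀ i → c i ≡ d i) →
               IsCycle G m c → IsCycle G m d
cong-IsCycle G m c≗d (inj , step , close) =
    (λ {i} {j} e → inj (trans (c≗d i) (trans e (sym (c≗d j)))))
  , (λ i → subst₂ (Adj G) (c≗d _) (c≗d _) (step i))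
  , subst₂ (Adj G) (c≗d _) (c≗d _) close

isCycle? : ∀ {V} → DecidableEquality V → (G : Graph V) →
           ∀ m c → Dec (IsCycle G m c)
isCycle? _≟_ G m c =
  map′ (λ f {i} {j} → f i j) (λ f i j → f)
    (all? λ i → all? λ j → (c i ≟ c j) →-dec (i Fin.≟ j))
  ×-dec (all? λ i → adj? G _ _)
  ×-dec adj? G _ _

hasCycle? : ∀ {n} (G : Graph (Fin n)) S → Dec (HasCycle (induced G S))
hasCycle? {n} G S =
  map′ (λ { (m , _ , xs , p) → m , lookup xs , p })
       (λ { (m , c , p) → m , bound m c p , tabulate c
                        , cong-IsCycle H m (sym ∘ lookup∘tabulate c) p })
    (anyUpTo? (λ m → searchVec (searchSubset S) (3 + m)
                       λ xs → isCycle? _≟_ H m (lookup xs)) n)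
  where
  H = induced G S
  _≟_ : DecidableEquality (∃ (_∈ S))
  u ≟ v = map′ proj₁-inj (cong proj₁) (proj₁ u Fin.≟ proj₁ v)
  bound : ∀ m c → IsCycle H m c → m < n
  bound m c (inj , _) =
    ℕ.≤-trans (s≤s (ℕ.m≤n+m m 2)) (injective⇒≤ {f = proj₁ ∘ c} (inj ∘ proj₁-inj))

isolatingSize? : ∀ {n} (G : Graph (Fin n)) → Decidable (IsolatingSize G)
isolatingSize? G k = anySubset? λ D → ¬? (hasCycle? G _) ×-dec (∣ D ∣ ℕ.≟ k)

∈-tabulate : ∀ {n} {P : Fin n → Set} (P? : Decidable P) {v} →
             P v → v ∈ tabulate (does ∘ P?)
∈-tabulate P? {v} p = lookup⇒[]= v _
  (trans (lookup∘tabulate (does ∘ P?) v) (dec-true (P? v) p))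

⊤-isolating : ∀ {n} (G : Graph (Fin n)) → CycleIsolating G ⊤
⊤-isolating G (_ , c , _) = x∈∁p⇒x∉p (proj₂ (c zero))
  (∈-tabulate (λ u → any? λ v → (v ∈? ⊤) ×-dec (u ∈? N[ G ] v))
    (w , ∈⊤ , ∈-tabulate (λ u → (u Fin.≟ w) ⊎-dec adj? G w u) (inj₁ refl)))
  where w = proj₁ (c zero)

least : {P : ℕ → Set} → Decidable P → ∀ k → P k → ∃ (IsMinimum P)
least {P} P? k pk with below (suc k)
  where
  below : ∀ k → ∃ (IsMinimum P) ⊎ (∀ j → P j → k ≤ j)
  below zero = inj₂ λ _ _ → z≤n
  below (suc k) with below k
  ... | inj₁ m = inj₁ m
  ... | inj₂ h with P? k
  ...   | yes p = inj₁ (k , p , h)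
  ...   | no ¬p = inj₂ λ j pj → ℕ.≤∧≢⇒< (h j pj) λ { refl → ¬p pj }
... | inj₁ m = m
... | inj₂ h = contradiction (h k pk) ℕ.1+n≰n

abstract
  minimum : ∀ {n} (G : Graph (Fin n)) → ∃ (IsMinimum (IsolatingSize G))
  minimum {n} G = least (isolatingSize? G) _ (⊤ {n} , ⊤-isolating G , refl)

ιc : ∀ {n} → Graph (Fin n) → ℕ
ιc G = proj₁ (minimum G)

ιc-isMinimum : ∀ {n} (G : Graph (Fin n)) → IsMinimum (IsolatingSize G) (ιc G)
ιc-isMinimum G = proj₂ (minimum G)

K : ∀ n → Graph (Fin n)
K n = record
  { Adj        = _≢_
  ; adj?       = λ u v → ¬? (u Fin.≟ v)
  ; adj-sym    = λ u≢v → u≢v ∘ sym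
  ; adj-irrefl = λ v≢v → v≢v refl
  }

-- The set [n] = {1, …, n} becomes Fin n, so that i ∈ [n] is the element x
-- with suc (toℕ x) ≡ i.

fromEdges : {V : Set} (E : V → V → Set) → (∀ u v → Dec (E u v)) →
            (∀ {v} → ¬ E v v) → Graph V
fromEdges E E? irr = record
  { Adj        = λ u v → E u v ⊎ E v u
  ; adj?       = λ u v → E? u v ⊎-dec E? v u
  ; adj-sym    = swap
  ; adj-irrefl = λ { (inj₁ e) → irr e ; (inj₂ e) → irr e }
  }

P : ∀ n → Graph (Fin n)
P n = fromEdges (λ u v → suc (toℕ u) ≡ toℕ v) (λ u v → _ ℕ.≟ _) ℕ.1+n≢n

P* : ∀ a b → Graph (Fin b)
P* a b = fromEdges
  (λ u v → (suc (toℕ u) ≡ toℕ v × toℕ v < a) ⊎ (suc (toℕ u) ≡ a × a ≤ toℕ v))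
  (λ u v → ((_ ℕ.≟ _) ×-dec (_ <? _)) ⊎-dec ((_ ℕ.≟ _) ×-dec (_ ≤? _)))
  (λ { (inj₁ (e , _)) → ℕ.1+n≢n e
     ; (inj₂ (refl , a≤v)) → ℕ.1+n≰n a≤v })

-- The vertices of P* together with those of the triangles F₁, …, F_a, where
-- inj₂ (i , p) is the vertex p of the triangle attached to vertex i of P*.
withTriangles : ∀ a b → Graph (Fin b ⊎ (Fin a × Fin 3))
withTriangles a b = record
  { Adj        = Adj′
  ; adj?       = adj?′
  ; adj-sym    = λ {u} {v} → sym′ u v
  ; adj-irrefl = λ {v} → irrefl′ v
  }
  where
  V = Fin b ⊎ (Fin a × Fin 3)

  Adj′ : V → V → Set
  Adj′ (inj₁ x)       (inj₁ y)       = Adj (P* a b) x y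
  Adj′ (inj₁ x)       (inj₂ (i , p)) = toℕ x ≡ toℕ i
  Adj′ (inj₂ (i , p)) (inj₁ x)       = toℕ x ≡ toℕ i
  Adj′ (inj₂ (i , p)) (inj₂ (j , q)) = i ≡ j × Adj (K 3) p q

  adj?′ : ∀ u v → Dec (Adj′ u v)
  adj?′ (inj₁ x)       (inj₁ y)       = adj? (P* a b) x y
  adj?′ (inj₁ x)       (inj₂ (i , p)) = _ ℕ.≟ _
  adj?′ (inj₂ (i , p)) (inj₁ x)       = _ ℕ.≟ _
  adj?′ (inj₂ (i , p)) (inj₂ (j , q)) = (i Fin.≟ j) ×-dec adj? (K 3) p q

  sym′ : ∀ u v → Adj′ u v → Adj′ v u
  sym′ (inj₁ x) (inj₁ y) e = adj-sym (P* a b) e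
  sym′ (inj₁ x) (inj₂ _) e = e
  sym′ (inj₂ _) (inj₁ x) e = e
  sym′ (inj₂ (i , p)) (inj₂ (j , q)) (e , f) = sym e , adj-sym (K 3) f

  irrefl′ : ∀ v → ¬ Adj′ v v
  irrefl′ (inj₁ x)       e       = adj-irrefl (P* a b) e
  irrefl′ (inj₂ (i , p)) (_ , f) = adj-irrefl (K 3) f

B-order : ∀ n → n ∸ 3 * (n / 4) + n / 4 * 3 ≡ n
B-order n = trans (cong (λ k → n ∸ 3 * (n / 4) + k) (ℕ.*-comm (n / 4) 3))
  (ℕ.m∸n+n≡m (ℕ.≤-trans (ℕ.*-monoˡ-≤ (n / 4) (ℕ.n≤1+n 3))
    (ℕ.≤-trans (ℕ.≤-reflexive (ℕ.*-comm 4 (n / 4))) (m/n*n≤m n 4))))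

B-vertices : ∀ n → Fin n ↔ (Fin (n ∸ 3 * (n / 4)) ⊎ (Fin (n / 4) × Fin 3))
B-vertices n = (↔-id _ ⊎-↔ *↔×) ↔-∘ (+↔⊎ ↔-∘ cast-id (sym (B-order n)))

B : ∀ n → Graph (Fin n)
B n = if does (n ≤? 3) then P n
      else relabel (B-vertices n) (withTriangles (n / 4) (n ∸ 3 * (n / 4)))

IsMaxιc : ℕ → ℕ → Set₁
IsMaxιc n = IsMaximum λ k →
  ∃ λ (G : Graph (Fin n)) → Connected G × ¬ (G ≅ K 3) × ιc G ≡ k

{-# OPTIONS --safe #-}
-- For the upper bound, the set S of vertices still present never has a triangle
-- component, and we find D with 4∣D∣ ≤ ∣S∣ by induction on ∣S∣: delete from S a set X
-- of at least four vertices and put one vertex x into D, such that no cycle avoiding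
-- N[x] meets X and S ∖ X again has no triangle component. If S − x has a triangle
-- component for some x, then X is x with all these components. Otherwise vertices of
-- degree at most 1 can be dropped for free. If a vertex v has degree at least 3, then
-- X = N[v] works unless S ∖ N[v] has a triangle component H; some y in H has a
-- neighbour x in N(v), and X = {x} ∪ H, which lies in N[y], works unless v has degree 3
-- and forms a triangle with its other two neighbours, one of which can then play the
-- role of x; the only case left is a component on seven vertices. If all degrees
-- are 2, then X consists of four consecutive vertices of a cycle.
--
-- For the lower bound, D has to meet the closed neighbourhood of each triangle Fᵢ of
-- B n, and these are pairwise disjoint.
module Submission where

open import Defs
open import Data.Bool.Base using (true; false; if_then_else_)
open import Data.Fin.Base using (Fin; zero; suc; toℕ; fromℕ; fromℕ<; inject₁; inject≤)
open import Data.Fin.Induction using (<-weakInduction)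
open import Data.Fin.Permutation using (↔⇒≡)
open import Data.Fin.Properties as Fin using (any?; all?)
open import Data.Fin.Relation.Unary.Top using (view; ‵fromℕ; ‵inject₁)
open import Data.Fin.Subset
  using (Subset; inside; outside; _∈_; _⊆_; ∣_∣; _∪_; ⁅_⁆; ⊥; ⊤; ∁)
open import Data.Fin.Subset.Properties
open import Data.Integer.Base as ℤ using (+_)
open import Data.Integer.Properties as ℤ using ()
open import Data.List.Base as List using (List; []; _∷_; length)
import Data.List.Membership.DecPropositional as DecMembership
open import Data.List.Membership.Propositional using ()
  renaming (_∈_ to _∈ₗ_; _∉_ to _∉ₗ_)
open import Data.List.Membership.Propositional.Properties using ()
  renaming (∈-tabulate⁻ to ∈ₗ-tabulate⁻)
open import Data.List.Properties using (length-tabulate)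
open import Data.List.Relation.Unary.All as All using ([]; _∷_)
open import Data.List.Relation.Unary.AllPairs using ([]; _∷_)
open import Data.List.Relation.Unary.Any as Any using (here; there)
open import Data.List.Relation.Unary.Any.Properties using (lookup-index)
open import Data.List.Relation.Unary.Unique.Propositional using (Unique)
open import Data.List.Relation.Unary.Unique.Propositional.Properties using (tabulate⁺)
open import Data.Nat.Base
  using (ℕ; zero; suc; _+_; _*_; _∸_; _≤_; _<_; _≥_; s≤s; z≤n; s≤s⁻¹)
open import Data.Nat.DivMod
  using (_/_; m/n*n≤m; m*n/n≡m; /-monoˡ-≤; m≥n⇒m/n>0; m<n⇒m/n≡0)
open import Data.Nat.Properties as ℕ using (_≤?_)
open import Data.Product.Base using (∃; ∃₂; _×_; _,_; proj₁; proj₂)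
open import Data.Rational.Unnormalised.Base as ℚᵘ using ()
open import Data.Sum.Base using (_⊎_; inj₁; inj₂; [_,_]′)
open import Data.Vec.Base using (tabulate; []; _∷_)
open import Data.Vec.Properties using (lookup∘tabulate; []=⇒lookup)
open import Function.Base using (_∘_)
open import Function.Bundles
  using (_↔_; Inverse; Injection; Equivalence; mk⇔; mk↔ₛ′)
open import Function.Properties.Inverse using (↔⇒↣)
open import Relation.Binary.Construct.Closure.ReflexiveTransitive
  using (Star; ε; _◅_; _◅◅_; gmap; reverse)
open import Relation.Binary.PropositionalEquality
open import Relation.Nullary using (¬_; Dec; yes; no; does; contradiction)
open import Relation.Nullary.Decidable
  using (decidable-stable; ¬?; _×-dec_; _⊎-dec_; _→-dec_)
open import Relation.Unary using (Decidable)

-- Decisions and counting in finite subsets.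

if-elim : ∀ {a p} {A : Set a} (Q : A → Set p) {x y : A} b →
          (b ≡ true → Q x) → (b ≡ false → Q y) → Q (if b then x else y)
if-elim Q true  t f = t refl
if-elim Q false t f = f refl

does-true : ∀ {A : Set} (A? : Dec A) → does A? ≡ true → A
does-true (yes a) _ = a

does-false : ∀ {A : Set} (A? : Dec A) → does A? ≡ false → ¬ A
does-false (no ¬a) _ = ¬a

∈-tabulate⁻ : ∀ {n} {P : Fin n → Set} (P? : Decidable P) {v} →
              v ∈ tabulate (does ∘ P?) → P v
∈-tabulate⁻ P? {v} v∈ =
  does-true (P? v) (trans (sym (lookup∘tabulate (does ∘ P?) v)) ([]=⇒lookup v∈))

∣p∪q∣≤∣p∣+∣q∣ : ∀ {n} (p q : Subset n) → ∣ p ∪ q ∣ ≤ ∣ p ∣ + ∣ q ∣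
∣p∪q∣≤∣p∣+∣q∣ []            []            = z≤n
∣p∪q∣≤∣p∣+∣q∣ (outside ∷ p) (outside ∷ q) = ∣p∪q∣≤∣p∣+∣q∣ p q
∣p∪q∣≤∣p∣+∣q∣ (outside ∷ p) (inside  ∷ q) =
  ℕ.≤-trans (s≤s (∣p∪q∣≤∣p∣+∣q∣ p q)) (ℕ.≤-reflexive (sym (ℕ.+-suc ∣ p ∣ ∣ q ∣)))
∣p∪q∣≤∣p∣+∣q∣ (inside  ∷ p) (outside ∷ q) = s≤s (∣p∪q∣≤∣p∣+∣q∣ p q)
∣p∪q∣≤∣p∣+∣q∣ (inside  ∷ p) (inside  ∷ q) =
  s≤s (ℕ.≤-trans (∣p∪q∣≤∣p∣+∣q∣ p q) (ℕ.+-monoʳ-≤ ∣ p ∣ (ℕ.n≤1+n ∣ q ∣)))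

infixl 6 _∖_

_∖_ : ∀ {n} → Subset n → {Q : Fin n → Set} → Decidable Q → Subset n
S ∖ Q? = tabulate λ u → does ((u ∈? S) ×-dec ¬? (Q? u))

module _ {n} {S : Subset n} {Q : Fin n → Set} (Q? : Decidable Q) where

  ∈∖⁺ : ∀ {u} → u ∈ S → ¬ Q u → u ∈ S ∖ Q?
  ∈∖⁺ u∈S ¬q = ∈-tabulate (λ u → (u ∈? S) ×-dec ¬? (Q? u)) (u∈S , ¬q)

  ∈∖⁻ : ∀ {u} → u ∈ S ∖ Q? → u ∈ S × ¬ Q u
  ∈∖⁻ = ∈-tabulate⁻ (λ u → (u ∈? S) ×-dec ¬? (Q? u))

  ∖⊆ : S ∖ Q? ⊆ S
  ∖⊆ = proj₁ ∘ ∈∖⁻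

-- Induction on the list: the head is removed from `T`, and uniqueness keeps the other listed
-- vertices in what remains. This measures how much a deletion shrinks `S` and, with an empty `S`,
-- bounds the length of a list of distinct members of `T`.
length+∣S∣≤∣T∣ : ∀ {n} {S T : Subset n} {xs} → Unique xs → S ⊆ T →
                 (∀ {u} → u ∈ₗ xs → u ∈ T × ¬ u ∈ S) → length xs + ∣ S ∣ ≤ ∣ T ∣
length+∣S∣≤∣T∣ []       S⊆T xs∈ = p⊆q⇒∣p∣≤∣q∣ S⊆T
length+∣S∣≤∣T∣ {S = S} {T} {x ∷ xs} (x∉xs ∷ uniq) S⊆T xs∈ =
  ℕ.≤-<-trans
    (length+∣S∣≤∣T∣ uniq
      (λ u∈S → x∈p∧x≢y⇒x∈p-y (S⊆T u∈S) λ { refl → proj₂ (xs∈ (here refl)) u∈S })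
      (λ u∈xs → x∈p∧x≢y⇒x∈p-y (proj₁ (xs∈ (there u∈xs))) (λ e → All.lookup x∉xs u∈xs (sym e))
              , proj₂ (xs∈ (there u∈xs))))
    (x∈p⇒∣p-x∣<∣p∣ (proj₁ (xs∈ (here refl))))

-- Cores, domination and triangle components.

module _ {n} (G : Graph (Fin n)) where

  private
    V = Fin n
    infix 4 _~_
    _~_ : V → V → Set
    _~_ = Adj G

    ~-sym : ∀ {u v} → u ~ v → v ~ u
    ~-sym = adj-sym G

    ~⇒≢ : ∀ {u v} → u ~ v → u ≢ v
    ~⇒≢ u~u refl = adj-irrefl G u~u

  open DecMembership (Fin._≟_ {n}) using () renaming (_∈?_ to _∈ₗ?_)

  -- The vertex set of a cycle is a core, and cores are easier to track than cycles.
  Core : (V → Set) → Set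
  Core W = ∃ W × (∀ {u} → W u → ∃₂ λ p q → p ≢ q × (W p × u ~ p) × (W q × u ~ q))

  Dominates : V → V → Set
  Dominates d u = u ≡ d ⊎ d ~ u

  dominates? : ∀ d → Decidable (Dominates d)
  dominates? d u = (u Fin.≟ d) ⊎-dec adj? G d u

  Avoids : (V → Set) → V → Set
  Avoids W x = ∀ {u} → W u → ¬ Dominates x u

  -- Arbitrary predicates `W` are allowed, so the image of a cycle can be inserted without first
  -- being turned into a `Subset`.
  Isolates : Subset n → Subset n → Set₁
  Isolates S D = ∀ {W : V → Set} → Core W → (∀ {u} → W u → u ∈ S) → (∀ {d} → d ∈ D → Avoids W d) → ¬ ∃ W

  Bounded : Subset n → Set₁
  Bounded S = ∃ λ D → Isolates S D × 4 * ∣ D ∣ ≤ ∣ S ∣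

  -- `S ∩ X` is then a union of components of `S`.
  Closed : Subset n → (V → Set) → Set
  Closed S X = ∀ p → X p → ∀ u → u ∈ S → p ~ u → X u

  triple : V → V → V → List V
  triple a b c = a ∷ b ∷ c ∷ []

  -- A component of the subgraph induced by S that is a triangle.
  ClosedTriangle : Subset n → V → V → V → Set
  ClosedTriangle S a b c =
    (a ∈ S × b ∈ S × c ∈ S) × (a ~ b × b ~ c × a ~ c) × Closed S (_∈ₗ triple a b c)

  closedTriangle? : ∀ S a b c → Dec (ClosedTriangle S a b c)
  closedTriangle? S a b c =
    ((a ∈? S) ×-dec (b ∈? S) ×-dec (c ∈? S))
    ×-dec (adj? G a b ×-dec adj? G b c ×-dec adj? G a c)
    ×-dec (all? λ p → (p ∈ₗ? triple a b c) →-dec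
            all? λ u → (u ∈? S) →-dec adj? G p u →-dec (u ∈ₗ? triple a b c))

  -- Only triangle components are excluded; a triangle with a further neighbour in `S` is allowed.
  TriangleFree : Subset n → Set
  TriangleFree S = ∀ {a b c} → ¬ ClosedTriangle S a b c

  hasTriangle? : ∀ S → Dec (∃ λ a → ∃₂ (ClosedTriangle S a))
  hasTriangle? S = any? λ a → any? λ b → any? λ c → closedTriangle? S a b c

  triangleFree : ∀ {S} → ¬ (∃ λ a → ∃₂ (ClosedTriangle S a)) → TriangleFree S
  triangleFree ¬t t = ¬t (_ , _ , _ , t)

  rotate : ∀ {S a b c} → ClosedTriangle S a b c → ClosedTriangle S b c a
  rotate ((a∈ , b∈ , c∈) , (ab , bc , ac) , closed) =
    (b∈ , c∈ , a∈) , (bc , ~-sym ac , ~-sym ab) ,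
    λ p p∈ u u∈S p~u → rot (closed p (rot⁻ p∈) u u∈S p~u)
    where
    rot : ∀ {a b c u : V} → u ∈ₗ triple a b c → u ∈ₗ triple b c a
    rot (here e)                 = there (there (here e))
    rot (there (here e))         = here e
    rot (there (there (here e))) = there (here e)
    rot⁻ : ∀ {a b c u : V} → u ∈ₗ triple b c a → u ∈ₗ triple a b c
    rot⁻ = rot ∘ rot

  swap₂₃ : ∀ {S a b c} → ClosedTriangle S a b c → ClosedTriangle S a c b
  swap₂₃ ((a∈ , b∈ , c∈) , (ab , bc , ac) , closed) =
    (a∈ , c∈ , b∈) , (ac , ~-sym bc , ab) ,
    λ p p∈ u u∈S p~u → swp (closed p (swp p∈) u u∈S p~u)
    where
    swp : ∀ {a b c u : V} → u ∈ₗ triple a b c → u ∈ₗ triple a c b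
    swp (here e)                 = here e
    swp (there (here e))         = there (there (here e))
    swp (there (there (here e))) = there (here e)

  focus : ∀ {S a b c p} → ClosedTriangle S a b c → p ∈ₗ triple a b c →
          ∃₂ λ q r → ClosedTriangle S p q r × (∀ {u} → u ∈ₗ triple a b c → u ∈ₗ triple p q r)
  focus t (here refl)                 = _ , _ , t , λ u∈ → u∈
  focus t (there (here refl))         = _ , _ , rotate t , λ
    { (here e) → there (there (here e)) ; (there (here e)) → here e
    ; (there (there (here e))) → there (here e) }
  focus t (there (there (here refl))) = _ , _ , rotate (rotate t) , λ
    { (here e) → there (here e) ; (there (here e)) → there (there (here e))
    ; (there (there (here e))) → here e }

  -- A vertex of a triangle component has just two neighbours in `S`, so any two distinct ones
  -- complete the triangle.
  retarget : ∀ {S a b c v p q} → ClosedTriangle S a b c → v ∈ₗ triple a b c →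
             p ∈ S → v ~ p → q ∈ S → v ~ q → p ≢ q → ClosedTriangle S v p q
  retarget {v = v} {p} {q} t v∈ p∈S v~p q∈S v~q p≢q with focus t v∈
  ... | q′ , r′ , t′@(_ , _ , closed) , _
      with closed v (here refl) p p∈S v~p | closed v (here refl) q q∈S v~q
  ... | here refl                 | _                         = contradiction refl (~⇒≢ v~p)
  ... | _                         | here refl                 = contradiction refl (~⇒≢ v~q)
  ... | there (here refl)         | there (here refl)         = contradiction refl p≢q
  ... | there (here refl)         | there (there (here refl)) = t′
  ... | there (there (here refl)) | there (here refl)         = swap₂₃ t′
  ... | there (there (here refl)) | there (there (here refl)) = contradiction refl p≢q

  member : ∀ {S a b c u} → ClosedTriangle S a b c → u ∈ₗ triple a b c → u ∈ S
  member ((a∈ , b∈ , c∈) , _) (here refl)                 = a∈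
  member ((a∈ , b∈ , c∈) , _) (there (here refl))         = b∈
  member ((a∈ , b∈ , c∈) , _) (there (there (here refl))) = c∈

  -- Moving a triangle component to another vertex set only requires a check of the neighbours
  -- outside the triangle.
  transfer : ∀ {S S′ a b c} → ClosedTriangle S a b c →
             (∀ {p} → p ∈ₗ triple a b c → p ∈ S′) →
             (∀ {p u} → p ∈ₗ triple a b c → u ∈ S′ → p ~ u → ¬ u ∈ₗ triple a b c → u ∈ S) →
             ClosedTriangle S′ a b c
  transfer (_ , edges , closed) inS′ old =
    (inS′ (here refl) , inS′ (there (here refl)) , inS′ (there (there (here refl)))) , edges , cl
    where
    cl : Closed _ _
    cl p p∈ u u∈S′ p~u with u ∈ₗ? _
    ... | yes u∈ = u∈
    ... | no  u∉ = closed p p∈ u (old p∈ u∈S′ p~u u∉) p~u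

  -- The induction step.

  module Step (S : Subset n) (free : TriangleFree S)
              (rec : ∀ S′ → ∣ S′ ∣ < ∣ S ∣ → TriangleFree S′ → Bounded S′) where

    restrict : ∀ {Q W : V → Set} (Q? : Decidable Q) → (∀ {u} → W u → u ∈ S) → (∀ {u} → W u → ¬ Q u) →
               ∀ {u} → W u → u ∈ S ∖ Q?
    restrict Q? W⊆S W∩Q=∅ w = ∈∖⁺ Q? (W⊆S w) (W∩Q=∅ w)

    -- No core inside `S` meets `Q`, so the `D` found for the rest serves for `S` too; `x` makes the
    -- set strictly smaller.
    discard : ∀ {Q x} (Q? : Decidable Q) → x ∈ S → Q x → TriangleFree (S ∖ Q?) →
              (∀ {W : V → Set} → Core W → (∀ {u} → W u → u ∈ S) → ∀ {u} → W u → ¬ Q u) → Bounded S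
    discard {x = x} Q? x∈S Qx free′ safe =
      let ∣S′∣<∣S∣ = length+∣S∣≤∣T∣ {S = S ∖ Q?} ([] ∷ []) (∖⊆ Q?)
                       λ { (here refl) → x∈S , λ x∈ → proj₂ (∈∖⁻ Q? x∈) Qx }
          D , iso , le = rec (S ∖ Q?) ∣S′∣<∣S∣ free′
      in D , (λ core W⊆S → iso core (restrict Q? W⊆S (safe core W⊆S)))
           , ℕ.≤-trans le (ℕ.<⇒≤ ∣S′∣<∣S∣)

    -- The four listed vertices pay for the one vertex `x` added to `D`, and `safe` says that cores
    -- avoiding `N[x]` survive the restriction to `S ∖ Q?`.
    select : ∀ {Q a b c d} x (Q? : Decidable Q) → Unique (a ∷ b ∷ c ∷ d ∷ []) →
             (∀ {u} → u ∈ₗ a ∷ b ∷ c ∷ d ∷ [] → u ∈ S × Q u) → TriangleFree (S ∖ Q?) →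
             (∀ {W : V → Set} → Core W → (∀ {u} → W u → u ∈ S) → Avoids W x → ∀ {u} → W u → ¬ Q u) →
             Bounded S
    select x Q? uniq abcd free′ safe =
      let 4+∣S′∣≤∣S∣ = length+∣S∣≤∣T∣ {S = S ∖ Q?} uniq (∖⊆ Q?)
                         λ u∈ → proj₁ (abcd u∈) , λ u∈′ → proj₂ (∈∖⁻ Q? u∈′) (proj₂ (abcd u∈))
          D , iso , le = rec (S ∖ Q?) (ℕ.≤-trans (s≤s (ℕ.m≤n+m _ 3)) 4+∣S′∣≤∣S∣) free′
      in ⁅ x ⁆ ∪ D
       , (λ core W⊆S avoid → iso core
            (restrict Q? W⊆S (safe core W⊆S (avoid (x∈p∪q⁺ (inj₁ (x∈⁅x⁆ x))))))
            (λ d∈D → avoid (x∈p∪q⁺ {p = ⁅ x ⁆} (inj₂ d∈D))))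
       , (begin
            4 * ∣ ⁅ x ⁆ ∪ D ∣       ≤⟨ ℕ.*-monoʳ-≤ 4 (∣p∪q∣≤∣p∣+∣q∣ ⁅ x ⁆ D) ⟩
            4 * (∣ ⁅ x ⁆ ∣ + ∣ D ∣) ≡⟨ cong (λ k → 4 * (k + ∣ D ∣)) (∣⁅x⁆∣≡1 x) ⟩
            4 * (1 + ∣ D ∣)         ≡⟨ ℕ.*-distribˡ-+ 4 1 ∣ D ∣ ⟩
            4 + 4 * ∣ D ∣           ≤⟨ ℕ.+-monoʳ-≤ 4 le ⟩
            4 + ∣ S ∖ Q? ∣          ≤⟨ 4+∣S′∣≤∣S∣ ⟩
            ∣ S ∣                   ∎)
      where open ℕ.≤-Reasoning

    infixl 6 S−_
    S−_ : V → Subset n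
    S− x = S ∖ (Fin._≟ x)

    -- Here X consists of x and all triangle components of S − x. Each of these is
    -- joined to x, so deleting N[x] leaves at most two of its vertices, which have
    -- no other neighbours.
    cutTriangle : ∀ {x a b c} → x ∈ S → ClosedTriangle (S− x) a b c → Bounded S
    cutTriangle {x} {a} {b} {c} x∈S t@(_ , (ab , bc , ac) , _) =
      select x Q? uniq abcd free′ safe
      where
      InTriangle : V → Set
      InTriangle u = ∃₂ (ClosedTriangle (S− x) u)

      Q? : Decidable λ u → u ≡ x ⊎ InTriangle u
      Q? u = (u Fin.≟ x) ⊎-dec any? λ b → any? λ c → closedTriangle? (S− x) u b c

      outside-x : ∀ {u} → u ∈ S− x → u ∈ S × u ≢ x
      outside-x = ∈∖⁻ (Fin._≟ x)

      ≢x : ∀ {u} → u ∈ₗ triple a b c → x ≢ u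
      ≢x u∈ refl = proj₂ (outside-x (member t u∈)) refl

      uniq : Unique (x ∷ triple a b c)
      uniq = (≢x (here refl) ∷ ≢x (there (here refl)) ∷ ≢x (there (there (here refl))) ∷ [])
           ∷ (~⇒≢ ab ∷ ~⇒≢ ac ∷ []) ∷ (~⇒≢ bc ∷ []) ∷ [] ∷ []

      abcd : ∀ {u} → u ∈ₗ x ∷ triple a b c → u ∈ S × (u ≡ x ⊎ InTriangle u)
      abcd (here refl) = x∈S , inj₁ refl
      abcd (there u∈)  = let q , r , t′ , _ = focus t u∈
                         in proj₁ (outside-x (member t u∈)) , inj₂ (q , r , t′)

      free′ : TriangleFree (S ∖ Q?)
      free′ t′ = proj₂ (∈∖⁻ Q? (member t′ (here refl))) (inj₂ (_ , _ , transfer t′ inS− old))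
        where
        inS− : ∀ {p} → p ∈ₗ _ → p ∈ S− x
        inS− p∈ = let p∈S , ¬Qp = ∈∖⁻ Q? (member t′ p∈)
                  in ∈∖⁺ (Fin._≟ x) p∈S (¬Qp ∘ inj₁)
        old : ∀ {p u} → p ∈ₗ _ → u ∈ S− x → p ~ u → ¬ u ∈ₗ _ → u ∈ S ∖ Q?
        old p∈ u∈ p~u _ = ∈∖⁺ Q? (proj₁ (outside-x u∈)) λ
          { (inj₁ u≡x) → proj₂ (outside-x u∈) u≡x
          -- A triangle component of `S− x` containing `u` would also contain its neighbour `p`,
          -- which was not deleted.
          ; (inj₂ (_ , _ , tu)) →
              let q , r , tp , _ = focus tu (proj₂ (proj₂ tu) _ (here refl) _ (inS− p∈) (~-sym p~u))
              in proj₂ (∈∖⁻ Q? (member t′ p∈)) (inj₂ (q , r , tp)) }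

      safe : ∀ {W} → Core W → (∀ {u} → W u → u ∈ S) → Avoids W x →
             ∀ {u} → W u → ¬ (u ≡ x ⊎ InTriangle u)
      safe _ _ avoid w (inj₁ u≡x) = avoid w (inj₁ u≡x)
      safe {W} (_ , two) W⊆S avoid {u} w (inj₂ (_ , _ , t′)) with two w
      -- The two core neighbours of `u` complete its triangle, so the triangle lies in `W`. As `W`
      -- avoids `N[x]`, it is not joined to `x` and is a component of `S`.
      ... | p , q , p≢q , (wp , u~p) , (wq , u~q) = free (transfer t″ (W⊆S ∘ inW) old)
        where
        W⊆S− : ∀ {z} → W z → z ∈ S− x
        W⊆S− wz = ∈∖⁺ (Fin._≟ x) (W⊆S wz) (avoid wz ∘ inj₁)
        t″ : ClosedTriangle (S− x) u p q
        t″ = retarget t′ (here refl) (W⊆S− wp) u~p (W⊆S− wq) u~q p≢q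
        inW : ∀ {z} → z ∈ₗ triple u p q → W z
        inW (here refl)                 = w
        inW (there (here refl))         = wp
        inW (there (there (here refl))) = wq
        old : ∀ {y z} → y ∈ₗ triple u p q → z ∈ S → y ~ z → ¬ z ∈ₗ triple u p q → z ∈ S− x
        old y∈ z∈S y~z _ = ∈∖⁺ (Fin._≟ x) z∈S λ { refl → avoid (inW y∈) (inj₂ (~-sym y~z)) }

    -- Vertices of degree at most one, and the two-regular case.

    TwoNeighbours : V → V → V → Set
    TwoNeighbours v p q = p ≢ q × (p ∈ S × v ~ p) × (q ∈ S × v ~ q)

    twoNeighbours? : ∀ v p q → Dec (TwoNeighbours v p q)
    twoNeighbours? v p q = ¬? (p Fin.≟ q) ×-dec ((p ∈? S) ×-dec adj? G v p)
                                          ×-dec ((q ∈? S) ×-dec adj? G v q)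

    ThirdNeighbour : V → V → V → V → Set
    ThirdNeighbour v p q r = r ∈ S × v ~ r × r ≢ p × r ≢ q

    thirdNeighbour? : ∀ v p q r → Dec (ThirdNeighbour v p q r)
    thirdNeighbour? v p q r =
      (r ∈? S) ×-dec adj? G v r ×-dec ¬? (r Fin.≟ p) ×-dec ¬? (r Fin.≟ q)

    -- Every vertex of a core has two neighbours in it, so no core in `S` contains `v`.
    leaf : ∀ {v} → v ∈ S → TriangleFree (S− v) → (∀ {p q} → ¬ TwoNeighbours v p q) → Bounded S
    leaf {v} v∈S cut ¬two = discard (Fin._≟ v) v∈S refl cut λ
      { (_ , two) W⊆S w refl → let p , q , p≢q , (wp , v~p) , (wq , v~q) = two w
                               in ¬two (p≢q , (W⊆S wp , v~p) , (W⊆S wq , v~q)) }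

    twoRegular : ∀ {v} → v ∈ S →
                 (∀ {u} → u ∈ S → ∃₂ (TwoNeighbours u)) →
                 (∀ {u p q r} → u ∈ S → TwoNeighbours u p q → ¬ ThirdNeighbour u p q r) → Bounded S
    twoRegular {v} v∈S two ¬three = go (two v∈S)
      where
      only : ∀ {u p q r} → u ∈ S → TwoNeighbours u p q → r ∈ S → u ~ r → r ≡ p ⊎ r ≡ q
      only {p = p} {q} {r} u∈S t r∈S u~r with r Fin.≟ p | r Fin.≟ q
      ... | yes e | _     = inj₁ e
      ... | no _  | yes e = inj₂ e
      ... | no r≢p | no r≢q = contradiction (r∈S , u~r , r≢p , r≢q) (¬three u∈S t)

      -- A triangle uses up both neighbours of each of its vertices, so it would be a component of
      -- `S` already.
      subset-free : ∀ {S′ a b c} → S′ ⊆ S → ¬ ClosedTriangle S′ a b c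
      subset-free {S′} S′⊆S t = free (transfer t (S′⊆S ∘ member t) old)
        where
        old : ∀ {p u} → p ∈ₗ _ → u ∈ S → p ~ u → ¬ u ∈ₗ _ → u ∈ S′
        old p∈ u∈S p~u _ with focus t p∈
        ... | q , r , ((_ , q∈ , r∈) , (pq , qr , pr) , _) , _
            with only (S′⊆S (member t p∈)) (~⇒≢ qr , (S′⊆S q∈ , pq) , (S′⊆S r∈ , pr)) u∈S p~u
        ...   | inj₁ refl = q∈
        ...   | inj₂ refl = r∈

      -- The consecutive vertices are `b`, `v`, `a`, `c`. Choosing `a` covers all but `b`, which
      -- loses its neighbour `v` and hence lies in no remaining core.
      path : ∀ {a b c} → TwoNeighbours v a b → c ∈ S → a ~ c → c ≢ v → c ≢ b → Bounded S
      path {a} {b} {c} (a≢b , (a∈S , v~a) , (b∈S , v~b)) c∈S a~c c≢v c≢b =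
        select a (_∈ₗ? v ∷ a ∷ b ∷ c ∷ [])
          ((~⇒≢ v~a ∷ ~⇒≢ v~b ∷ c≢v ∘ sym ∷ []) ∷ (a≢b ∷ ~⇒≢ a~c ∷ []) ∷ (c≢b ∘ sym ∷ []) ∷ [] ∷ [])
          (λ u∈ → inS u∈ , u∈)
          (subset-free (∖⊆ (_∈ₗ? v ∷ a ∷ b ∷ c ∷ [])))
          safe
        where
        inS : ∀ {u} → u ∈ₗ v ∷ a ∷ b ∷ c ∷ [] → u ∈ S
        inS (here refl)                         = v∈S
        inS (there (here refl))                 = a∈S
        inS (there (there (here refl)))         = b∈S
        inS (there (there (there (here refl)))) = c∈S
        safe : ∀ {W} → Core W → (∀ {u} → W u → u ∈ S) → Avoids W a →
               ∀ {u} → W u → ¬ u ∈ₗ v ∷ a ∷ b ∷ c ∷ []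
        safe _ _ avoid w (here refl)                         = avoid w (inj₂ (~-sym v~a))
        safe _ _ avoid w (there (here refl))                 = avoid w (inj₁ refl)
        safe _ _ avoid w (there (there (there (here refl)))) = avoid w (inj₂ a~c)
        safe (_ , twoW) W⊆S avoid w (there (there (here refl))) with twoW w
        ... | p , q , p≢q , (wp , b~p) , (wq , b~q)
            with only b∈S (p≢q , (W⊆S wp , b~p) , (W⊆S wq , b~q)) v∈S (~-sym v~b)
        ...   | inj₁ refl = avoid wp (inj₂ (~-sym v~a))
        ...   | inj₂ refl = avoid wq (inj₂ (~-sym v~a))

      go : ∃₂ (TwoNeighbours v) → Bounded S
      go (a , b , t@(a≢b , (a∈S , v~a) , (b∈S , v~b))) with adj? G a b
      ... | yes a~b = contradiction
              ((v∈S , a∈S , b∈S) , (v~a , a~b , v~b) , λ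
                 { _ (here refl) u u∈S v~u → [ there ∘ here , there ∘ there ∘ here ]′ (only v∈S t u∈S v~u)
                 ; _ (there (here refl)) u u∈S a~u →
                     [ here , there ∘ there ∘ here ]′
                       (only a∈S (~⇒≢ v~b , (v∈S , ~-sym v~a) , (b∈S , a~b)) u∈S a~u)
                 ; _ (there (there (here refl))) u u∈S b~u →
                     [ here , there ∘ here ]′
                       (only b∈S (~⇒≢ v~a , (v∈S , ~-sym v~b) , (a∈S , ~-sym a~b)) u∈S b~u) })
              free
      -- One of the two neighbours of `a` is not `v`; it becomes the fourth vertex, and it is not
      -- `b` because `a` and `b` are not adjacent.
      ... | no a≁b with two a∈S
      ...   | p , q , p≢q , (p∈S , a~p) , (q∈S , a~q) with p Fin.≟ v
      ...     | no p≢v   = path t p∈S a~p p≢v λ { refl → a≁b a~p }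
      ...     | yes refl = path t q∈S a~q (p≢q ∘ sym) λ { refl → a≁b a~q }

    -- Since `X` is closed, a core vertex in `X` has its two core neighbours in `X` as well. With
    -- only three candidates, all three must occur and be pairwise adjacent. The names may coincide,
    -- whence `q ≢ r` in the conclusion.
    trap : ∀ {X W p q r} → Closed S X → Core W → (∀ {u} → W u → u ∈ S) →
           (∀ {u} → W u → X u → u ∈ₗ triple p q r) →
           ∀ {u} → W u → X u → q ≢ r × p ~ q × p ~ r
    trap {X} {W} {p} {q} {r} closed (_ , two) W⊆S small w x = reach (small w x) w x
      where
      neighbours : ∀ {u} → W u → X u → ∃₂ λ s t → s ≢ t ×
                   (s ∈ₗ triple p q r × W s × X s × u ~ s) × (t ∈ₗ triple p q r × W t × X t × u ~ t)
      neighbours w x =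
        let s , t , s≢t , (ws , u~s) , (wt , u~t) = two w
            xs = closed _ x s (W⊆S ws) u~s
            xt = closed _ x t (W⊆S wt) u~t
        in s , t , s≢t , (small ws xs , ws , xs , u~s) , (small wt xt , wt , xt , u~t)

      atp : W p → X p → q ≢ r × p ~ q × p ~ r
      atp w x with neighbours w x
      ... | _ , _ , s≢t , (here refl , _ , _ , p~p) , _ = contradiction refl (~⇒≢ p~p)
      ... | _ , _ , s≢t , _ , (here refl , _ , _ , p~p) = contradiction refl (~⇒≢ p~p)
      ... | _ , _ , s≢t , (there (here refl) , _ , _ , p~q) , (there (there (here refl)) , _ , _ , p~r) =
            s≢t , p~q , p~r
      ... | _ , _ , s≢t , (there (there (here refl)) , _ , _ , p~r) , (there (here refl) , _ , _ , p~q) =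
            s≢t ∘ sym , p~q , p~r
      ... | _ , _ , s≢t , (there (here refl) , _) , (there (here refl) , _) = contradiction refl s≢t
      ... | _ , _ , s≢t , (there (there (here refl)) , _) , (there (there (here refl)) , _) =
            contradiction refl s≢t

      reach : ∀ {u} → u ∈ₗ triple p q r → W u → X u → q ≢ r × p ~ q × p ~ r
      reach (here refl) w x = atp w x
      reach (there _)   w x with neighbours w x
      reach (there _) w x | _ , _ , _ , (here refl , w′ , x′ , _) , _ = atp w′ x′
      reach (there _) w x | _ , _ , _ , _ , (here refl , w′ , x′ , _) = atp w′ x′
      -- If neither neighbour of `q` is `p`, both equal `r`, although they are distinct.
      reach (there (here refl)) w x | _ , _ , s≢t , (there s , _ , _ , u~s) , (there t , _ , _ , u~t) =
        contradiction (trans (last s u~s) (sym (last t u~t))) s≢t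
        where
        last : ∀ {z} → z ∈ₗ q ∷ r ∷ [] → q ~ z → z ≡ r
        last (here refl)         q~q = contradiction refl (~⇒≢ q~q)
        last (there (here refl)) _   = refl
      reach (there (there (here refl))) w x | _ , _ , s≢t , (there s , _ , _ , u~s) , (there t , _ , _ , u~t) =
        contradiction (trans (last s u~s) (sym (last t u~t))) s≢t
        where
        last : ∀ {z} → z ∈ₗ q ∷ r ∷ [] → r ~ z → z ≡ q
        last (here refl)         _   = refl
        last (there (here refl)) r~r = contradiction refl (~⇒≢ r~r)

    -- If the triangle is no longer a component in `S″`, a finite search finds an edge leaving it.
    escape : ∀ {S′ S″ a b c} → ClosedTriangle S′ a b c → (∀ {p} → p ∈ₗ triple a b c → p ∈ S″) →
             ¬ ClosedTriangle S″ a b c →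
             ∃₂ λ p u → p ∈ₗ triple a b c × u ∈ S″ × p ~ u × u ∉ₗ triple a b c
    escape {S″ = S″} {a} {b} {c} t inS″ ¬t
      with (any? λ p → any? λ u → (p ∈ₗ? triple a b c) ×-dec (u ∈? S″) ×-dec
                                  adj? G p u ×-dec ¬? (u ∈ₗ? triple a b c))
    ... | yes e = e
    ... | no ¬e = contradiction
            (transfer t inS″ λ p∈ u∈ p~u u∉ → contradiction (_ , _ , p∈ , u∈ , p~u , u∉) ¬e) ¬t

    dominatesTriangle : ∀ {S′ a b c y u} → ClosedTriangle S′ a b c → y ∈ₗ triple a b c →
                        u ∈ₗ triple a b c → Dominates y u
    dominatesTriangle t y∈ u∈ with focus t y∈
    ... | _ , _ , (_ , (yq , _ , yr) , _) , incl with incl u∈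
    ...   | here refl                 = inj₁ refl
    ...   | there (here refl)         = inj₂ yq
    ...   | there (there (here refl)) = inj₂ yr

    -- A triangle component `H` left outside `N[v]`.

    module Hub (cut : ∀ {x} → x ∈ S → TriangleFree (S− x)) {v} (v∈S : v ∈ S) {h₁ h₂ h₃}
               (tH : ClosedTriangle (S ∖ dominates? v) h₁ h₂ h₃) where

      H : List V
      H = triple h₁ h₂ h₃

      H⊆S : ∀ {u} → u ∈ₗ H → u ∈ S
      H⊆S = ∖⊆ (dominates? v) ∘ member tH

      v≁H : ∀ {u} → u ∈ₗ H → ¬ Dominates v u
      v≁H = proj₂ ∘ ∈∖⁻ (dominates? v) ∘ member tH

      -- `H` is closed outside `N[v]`, so its edges to other vertices of `S` end in `N[v]`, and not
      -- at `v` itself.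
      exits : ∀ {u w} → u ∈ₗ H → w ∈ S → u ~ w → w ∉ₗ H → v ~ w
      exits {u} {w} u∈H w∈S u~w w∉H with dominates? v w
      ... | yes (inj₁ refl) = contradiction (inj₂ (~-sym u~w)) (v≁H u∈H)
      ... | yes (inj₂ v~w)  = v~w
      ... | no ¬dom         =
        contradiction (proj₂ (proj₂ tH) u u∈H w (∈∖⁺ (dominates? v) w∈S ¬dom) u~w) w∉H

      -- A triangle component T of S ∖ ({x} ∪ H) contains v: otherwise T avoids N[v],
      -- so T is not joined to H, and T is then a component of S − x.
      link : ∀ {x y p q} → x ∈ S → v ~ x → y ∈ₗ H → y ~ x → TwoNeighbours v p q → p ≢ x → q ≢ x →
             Bounded S ⊎ ClosedTriangle (S ∖ (_∈ₗ? x ∷ H)) v p q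
      link {x} {y} {p} {q} x∈S v~x y∈H y~x (p≢q , (p∈S , v~p) , (q∈S , v~q)) p≢x q≢x
        with hasTriangle? (S ∖ (_∈ₗ? x ∷ H))
      ... | no ¬t = inj₁ (select y (_∈ₗ? x ∷ H)
                (((λ { refl → x≁H (here refl) }) ∷ (λ { refl → x≁H (there (here refl)) })
                    ∷ (λ { refl → x≁H (there (there (here refl))) }) ∷ [])
                 ∷ (~⇒≢ ab ∷ ~⇒≢ ac ∷ []) ∷ (~⇒≢ bc ∷ []) ∷ [] ∷ [])
                (λ { (here refl) → x∈S , here refl ; (there u∈) → H⊆S u∈ , there u∈ })
                (triangleFree ¬t)
                λ { _ _ avoid w (here refl) → avoid w (inj₂ y~x)
                  ; _ _ avoid w (there u∈)  → avoid w (dominatesTriangle tH y∈H u∈) })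
        where
        x≁H : ¬ x ∈ₗ H
        x≁H x∈H = v≁H x∈H (inj₂ v~x)
        ab = proj₁ (proj₁ (proj₂ tH))
        bc = proj₁ (proj₂ (proj₁ (proj₂ tH)))
        ac = proj₂ (proj₂ (proj₁ (proj₂ tH)))
      ... | yes (a , b , c , t) with v ∈ₗ? triple a b c
      -- `v` has no neighbour in `H`, so `p` and `q` survive the deletion and are the other two
      -- vertices of the triangle.
      ...   | yes v∈T = inj₂ (retarget t v∈T (stays p∈S v~p p≢x) v~p (stays q∈S v~q q≢x) v~q p≢q)
        where
        stays : ∀ {u} → u ∈ S → v ~ u → u ≢ x → u ∈ S ∖ (_∈ₗ? x ∷ H)
        stays u∈S v~u u≢x = ∈∖⁺ (_∈ₗ? x ∷ H) u∈S λ
          { (here u≡x) → u≢x u≡x ; (there u∈H) → v≁H u∈H (inj₂ v~u) }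
      ...   | no v∉T = contradiction (transfer t inS− old) (cut x∈S)
        where
        inS− : ∀ {z} → z ∈ₗ triple a b c → z ∈ S− x
        inS− z∈ = let z∈S , z∉ = ∈∖⁻ (_∈ₗ? x ∷ H) (member t z∈)
                  in ∈∖⁺ (Fin._≟ x) z∈S (z∉ ∘ here)
        v∈ : v ∈ S ∖ (_∈ₗ? x ∷ H)
        v∈ = ∈∖⁺ (_∈ₗ? x ∷ H) v∈S λ
          { (here refl) → ~⇒≢ v~x refl ; (there v∈H) → v≁H v∈H (inj₁ refl) }
        old : ∀ {z u} → z ∈ₗ triple a b c → u ∈ S− x → z ~ u → ¬ u ∈ₗ triple a b c →
              u ∈ S ∖ (_∈ₗ? x ∷ H)
        old {z} z∈ u∈ z~u _ with ∈∖⁻ (_∈ₗ? x ∷ H) (member t z∈) | ∈∖⁻ (Fin._≟ x) u∈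
        ... | z∈S , z∉ | u∈S , u≢x = ∈∖⁺ (_∈ₗ? x ∷ H) u∈S λ
          { (here u≡x)  → u≢x u≡x
          ; (there u∈H) → v∉T (proj₂ (proj₂ t) z z∈ v v∈
                                (~-sym (exits u∈H z∈S (~-sym z~u) (z∉ ∘ there)))) }

      -- S ∩ X is a union of components of S with seven vertices, and D takes one
      -- vertex from it. After deleting N[p] only x, y₁, y₂ are left of X; if these
      -- form a triangle, then deleting N[x] instead leaves only p and y.
      kite : ∀ {x p q y} → x ∈ S → x ≢ p → x ≢ q → v ~ x → y ∈ₗ H → p ~ y →
             ClosedTriangle (S ∖ (_∈ₗ? x ∷ H)) v p q →
             ClosedTriangle (S ∖ (_∈ₗ? p ∷ H)) v x q → Bounded S
      kite {x} {p} {q} {y} x∈S x≢p x≢q v~x y∈H p~y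
           t@((v∈ , p∈ , q∈) , (vp , pq , vq) , closedT) t′@(_ , (vx , xq , _) , closedT′)
        with focus tH y∈H
      ... | y₁ , y₂ , _ , H⊆ = finish
        where
        X : V → Set
        X u = u ∈ₗ triple v p q ⊎ u ∈ₗ x ∷ H

        X? : Decidable X
        X? u = (u ∈ₗ? triple v p q) ⊎-dec (u ∈ₗ? x ∷ H)

        closedX : Closed S X
        closedX w (inj₁ w∈) z z∈S w~z with z ∈ₗ? x ∷ H
        ... | yes z∈ = inj₂ z∈
        ... | no  z∉ = inj₁ (closedT w w∈ z (∈∖⁺ (_∈ₗ? x ∷ H) z∈S z∉) w~z)
        -- Apart from `p` and `H`, the neighbours of `x` are governed by the second triangle `t′`.
        closedX w (inj₂ (here refl)) z z∈S x~z with z ∈ₗ? p ∷ H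
        ... | yes (here refl) = inj₁ (there (here refl))
        ... | yes (there z∈H) = inj₂ (there z∈H)
        ... | no  z∉ with closedT′ w (there (here refl)) z (∈∖⁺ (_∈ₗ? p ∷ H) z∈S z∉) x~z
        ...   | here refl                 = inj₁ (here refl)
        ...   | there (here refl)         = inj₂ (here refl)
        ...   | there (there (here refl)) = inj₁ (there (there (here refl)))
        closedX w (inj₂ (there w∈H)) z z∈S w~z with z ∈ₗ? H
        ... | yes z∈H = inj₂ (there z∈H)
        ... | no  z∉H = closedX v (inj₁ (here refl)) z z∈S (exits w∈H z∈S w~z z∉H)

        freeX : TriangleFree (S ∖ X?)
        freeX s = free (transfer s (∖⊆ X? ∘ member s) λ {w} w∈ z∈S w~z _ →
          let w∈S , w∉X = ∈∖⁻ X? (member s w∈)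
          in ∈∖⁺ X? z∈S λ z∈X → w∉X (closedX _ z∈X w w∈S (~-sym w~z)))

        T⊆S : ∀ {u} → u ∈ₗ triple v p q → u ∈ S
        T⊆S = ∖⊆ (_∈ₗ? x ∷ H) ∘ member t

        take : ∀ d → (∀ {W} → Core W → (∀ {u} → W u → u ∈ S) → Avoids W d → ∀ {u} → W u → ¬ X u) →
               Bounded S
        take d = select d X?
          ((x≢p ∷ ~⇒≢ v~x ∘ sym ∷ x≢q ∷ []) ∷ (~⇒≢ vp ∘ sym ∷ ~⇒≢ pq ∷ []) ∷ (~⇒≢ vq ∷ []) ∷ [] ∷ [])
          (λ { (here refl) → x∈S , inj₂ (here refl)
             ; (there (here refl)) → T⊆S (there (here refl)) , inj₁ (there (here refl))
             ; (there (there (here refl))) → T⊆S (here refl) , inj₁ (here refl)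
             ; (there (there (there (here refl)))) →
                 T⊆S (there (there (here refl))) , inj₁ (there (there (here refl))) })
          freeX

        -- Repeating `y` fills the third place, so that `trap` yields the absurd `y ≢ y`.
        leftover-x : ∀ {W} → x ~ y₁ → x ~ y₂ → Avoids W x → ∀ {u} → W u → X u → u ∈ₗ triple p y y
        leftover-x _ _ avoid w (inj₁ (here refl))                 = contradiction (inj₂ (~-sym vx)) (avoid w)
        leftover-x _ _ avoid w (inj₁ (there (here refl)))         = here refl
        leftover-x _ _ avoid w (inj₁ (there (there (here refl)))) = contradiction (inj₂ xq) (avoid w)
        leftover-x _ _ avoid w (inj₂ (here refl))                 = contradiction (inj₁ refl) (avoid w)
        leftover-x x~y₁ x~y₂ avoid w (inj₂ (there u∈H)) with H⊆ u∈H
        ... | here refl                 = there (here refl)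
        ... | there (here refl)         = contradiction (inj₂ x~y₁) (avoid w)
        ... | there (there (here refl)) = contradiction (inj₂ x~y₂) (avoid w)

        leftover-p : ∀ {W} → Avoids W p → ∀ {u} → W u → X u → u ∈ₗ triple x y₁ y₂
        leftover-p avoid w (inj₁ (here refl))                 = contradiction (inj₂ (~-sym vp)) (avoid w)
        leftover-p avoid w (inj₁ (there (here refl)))         = contradiction (inj₁ refl) (avoid w)
        leftover-p avoid w (inj₁ (there (there (here refl)))) = contradiction (inj₂ pq) (avoid w)
        leftover-p avoid w (inj₂ (here refl))                 = here refl
        leftover-p avoid w (inj₂ (there u∈H)) with H⊆ u∈H
        ... | here refl = contradiction (inj₂ p~y) (avoid w)
        ... | there u∈  = there u∈

        finish : Bounded S
        finish with adj? G x y₁ ×-dec adj? G x y₂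
        ... | yes (x~y₁ , x~y₂) = take x λ core W⊆S avoid w Xu →
                proj₁ (trap closedX core W⊆S (leftover-x x~y₁ x~y₂ avoid) w Xu) refl
        ... | no ¬both = take p λ core W⊆S avoid w Xu →
                ¬both (proj₂ (trap closedX core W⊆S (leftover-p avoid) w Xu))

      -- The triangle on `v`, `p`, `q` given by `link` is not a component of `S− x`, so an edge
      -- joins it to `H`. That edge starts at `p` or `q`; `link` applied to this vertex in place of
      -- `x` gives the second triangle for `kite`.
      linked : ∀ {x y p q} → x ∈ S → v ~ x → y ∈ₗ H → y ~ x → TwoNeighbours v p q → p ≢ x → q ≢ x →
               Bounded S
      linked {x} {y} {p} {q} x∈S v~x y∈H y~x pq@(p≢q , vp , vq) p≢x q≢x
        with link x∈S v~x y∈H y~x pq p≢x q≢x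
      ... | inj₁ done = done
      ... | inj₂ t
          with escape t (λ z∈ → let z∈S , z∉ = ∈∖⁻ (_∈ₗ? x ∷ H) (member t z∈)
                                in ∈∖⁺ (Fin._≟ x) z∈S (z∉ ∘ here)) (cut x∈S)
      ...   | w , u , w∈T , u∈S− , w~u , u∉T = attached w∈T (inH u∈S−) w~u
        where
        inH : u ∈ S− x → u ∈ₗ H
        inH u∈ with u ∈ₗ? x ∷ H
        ... | yes (here u≡x)  = contradiction u≡x (proj₂ (∈∖⁻ (Fin._≟ x) u∈))
        ... | yes (there u∈H) = u∈H
        ... | no  u∉ = contradiction
          (proj₂ (proj₂ t) w w∈T u (∈∖⁺ (_∈ₗ? x ∷ H) (∖⊆ (Fin._≟ x) u∈) u∉) w~u) u∉T

        via : ∀ {p q} → TwoNeighbours v p q → p ≢ x → q ≢ x →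
              ClosedTriangle (S ∖ (_∈ₗ? x ∷ H)) v p q → u ∈ₗ H → p ~ u → Bounded S
        via (p≢q , (p∈S , v~p) , vq) p≢x q≢x t u∈H p~u
          with link p∈S v~p u∈H (~-sym p~u) (q≢x ∘ sym , (x∈S , v~x) , vq) (p≢x ∘ sym) (p≢q ∘ sym)
        ... | inj₁ done = done
        ... | inj₂ t′   = kite x∈S (p≢x ∘ sym) (q≢x ∘ sym) v~x u∈H p~u t t′

        attached : w ∈ₗ triple v p q → u ∈ₗ H → w ~ u → Bounded S
        attached (here refl)                 u∈H w~u = contradiction (inj₂ w~u) (v≁H u∈H)
        attached (there (here refl))         u∈H w~u = via pq p≢x q≢x t u∈H w~u
        attached (there (there (here refl))) u∈H w~u =
          via (p≢q ∘ sym , vq , vp) q≢x p≢x (swap₂₃ t) u∈H w~u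

    -- `N[v]` has the four vertices `v`, `p`, `q`, `r`, so `select v` works unless a triangle
    -- component remains. That one is not a component of `S`, so an edge leaves it towards a
    -- neighbour `x` of `v`.
    hub : (∀ {x} → x ∈ S → TriangleFree (S− x)) →
          ∀ {v p q r} → v ∈ S → TwoNeighbours v p q → ThirdNeighbour v p q r → Bounded S
    hub cut {v} {p} {q} {r} v∈S pq@(p≢q , (p∈S , v~p) , (q∈S , v~q)) (r∈S , v~r , r≢p , r≢q)
      with hasTriangle? (S ∖ dominates? v)
    ... | no ¬t = select v (dominates? v)
            ((~⇒≢ v~p ∷ ~⇒≢ v~q ∷ ~⇒≢ v~r ∷ []) ∷ (p≢q ∷ r≢p ∘ sym ∷ []) ∷ (r≢q ∘ sym ∷ []) ∷ [] ∷ [])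
            (λ { (here refl) → v∈S , inj₁ refl
               ; (there (here refl)) → p∈S , inj₂ v~p
               ; (there (there (here refl))) → q∈S , inj₂ v~q
               ; (there (there (there (here refl)))) → r∈S , inj₂ v~r })
            (triangleFree ¬t) (λ _ _ avoid w → avoid w)
    ... | yes (_ , _ , _ , tH) with escape tH (∖⊆ (dominates? v) ∘ member tH) free
    -- At least two of `p`, `q`, `r` differ from `x`; they form the pair passed to `linked`.
    ...   | y , x , y∈H , x∈S , y~x , x∉H with Hub.exits cut v∈S tH y∈H x∈S y~x x∉H
    ...     | v~x with p Fin.≟ x | q Fin.≟ x
    ...       | no p≢x | no q≢x = Hub.linked cut v∈S tH x∈S v~x y∈H y~x pq p≢x q≢x
    ...       | yes refl | _ = Hub.linked cut v∈S tH x∈S v~x y∈H y~x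
                  (r≢q ∘ sym , (q∈S , v~q) , (r∈S , v~r)) (p≢q ∘ sym) r≢p
    ...       | no p≢x | yes refl = Hub.linked cut v∈S tH x∈S v~x y∈H y~x
                  (r≢p ∘ sym , (p∈S , v~p) , (r∈S , v~r)) p≢x r≢q

    step : Bounded S
    step with any? (_∈? S)
    ... | no ∅ = ⊥ , (λ { _ W⊆S _ (u , w) → ∅ (u , W⊆S w) })
               , ℕ.≤-trans (ℕ.≤-reflexive (cong (4 *_) (∣⊥∣≡0 n))) z≤n
    ... | yes (v , v∈S) with (any? λ x → (x ∈? S) ×-dec hasTriangle? (S− x))
    ...   | yes (_ , x∈S , _ , _ , _ , t) = cutTriangle x∈S t
    ...   | no ¬cut with (any? λ u → (u ∈? S) ×-dec ¬? (any? λ p → any? λ q → twoNeighbours? u p q))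
    ...     | yes (_ , u∈S , ¬two) =
                leaf u∈S (triangleFree λ t → ¬cut (_ , u∈S , t)) λ t → ¬two (_ , _ , t)
    ...     | no ¬leaf with (any? λ u → any? λ p → any? λ q → any? λ r →
                            (u ∈? S) ×-dec twoNeighbours? u p q ×-dec thirdNeighbour? u p q r)
    ...       | yes (_ , _ , _ , _ , u∈S , pq , r) =
                  hub (λ x∈S → triangleFree λ t → ¬cut (_ , x∈S , t)) u∈S pq r
    ...       | no ¬hub = twoRegular v∈S
                  (λ {u} u∈S → decidable-stable (any? λ p → any? λ q → twoNeighbours? u p q)
                                 λ ¬two → ¬leaf (u , u∈S , ¬two))
                  λ u∈S pq r → ¬hub (_ , _ , _ , _ , u∈S , pq , r)

  isolatingBound : ∀ m S → ∣ S ∣ < m → TriangleFree S → Bounded S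
  isolatingBound (suc m) S ∣S∣<1+m free =
    Step.step S free λ S′ S′<S → isolatingBound m S′ (ℕ.<-≤-trans S′<S (s≤s⁻¹ ∣S∣<1+m))

-- From cores to cycles, and the upper bound.

cycle-neighbours : ∀ {V} (G : Graph V) m {c} → IsCycle G m c → ∀ i →
                   ∃₂ λ j k → j ≢ k × Adj G (c i) (c j) × Adj G (c i) (c k)
cycle-neighbours G m (_ , step , close) zero =
  suc zero , fromℕ (2 + m) , (λ ()) , step zero , adj-sym G close
cycle-neighbours G m {c} (_ , step , close) (suc j) with suc j in eq | view (suc j)
... | _ | ‵fromℕ     =
  -- The last but one position is not `zero`, because the cycle has at least three vertices.
  inject₁ j , zero , (λ e → Fin.0≢1+n (trans (sym e) (cong inject₁ (Fin.suc-injective eq)))) ,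
  subst (λ i → Adj G (c i) (c (inject₁ j))) eq (adj-sym G (step j)) , close
... | _ | ‵inject₁ k =
  inject₁ j , suc k , apart , subst (λ i → Adj G (c i) (c (inject₁ j))) eq (adj-sym G (step j)) , step k
  where
  apart : inject₁ j ≢ suc k
  -- If predecessor and successor agreed, `toℕ k` would equal `2 + toℕ k`.
  apart e = ℕ.<⇒≢ (ℕ.m<n⇒m<1+n (ℕ.n<1+n (toℕ k))) (begin
    toℕ k               ≡⟨ Fin.toℕ-inject₁ k ⟨
    toℕ (inject₁ k)     ≡⟨ cong toℕ eq ⟨
    suc (toℕ j)         ≡⟨ cong suc (Fin.toℕ-inject₁ j) ⟨
    suc (toℕ (inject₁ j)) ≡⟨ cong (suc ∘ toℕ) e ⟩
    suc (suc (toℕ k))   ∎)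
    where open ≡-Reasoning

∈N[]ˢ : ∀ {n} (G : Graph (Fin n)) {D d u} → d ∈ D → Dominates G d u → u ∈ N[ G ]ˢ D
∈N[]ˢ G {D} {d} {u} d∈D dom =
  ∈-tabulate (λ u → any? λ v → (v ∈? D) ×-dec (u ∈? N[ G ] v))
    (d , d∈D , ∈-tabulate (dominates? G d) dom)

∈N[]ˢ⁻ : ∀ {n} (G : Graph (Fin n)) {D u} → u ∈ N[ G ]ˢ D → ∃ λ d → d ∈ D × Dominates G d u
∈N[]ˢ⁻ G {D} u∈ with ∈-tabulate⁻ (λ u → any? λ v → (v ∈? D) ×-dec (u ∈? N[ G ] v)) u∈
... | d , d∈D , u∈N = d , d∈D , ∈-tabulate⁻ (dominates? G d) u∈N

-- The vertices of a cycle outside `N[D]` form a core, each with its predecessor and successor as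
-- the two neighbours.
isolates⇒cycleIsolating : ∀ {n} (G : Graph (Fin n)) {D} → Isolates G ⊤ D → CycleIsolating G D
isolates⇒cycleIsolating G {D} iso (m , c , cyc@(inj , _)) =
  iso {W} (nonempty , two) (λ _ → ∈⊤) avoid nonempty
  where
  W : _ → Set
  W u = ∃ λ i → proj₁ (c i) ≡ u
  nonempty : ∃ W
  nonempty = _ , zero , refl
  two : ∀ {u} → W u → ∃₂ λ p q → p ≢ q × (W p × Adj G u p) × (W q × Adj G u q)
  two (i , refl) with cycle-neighbours (induced G (∁ (N[ G ]ˢ D))) m cyc i
  ... | j , k , j≢k , ij , ik =
    _ , _ , (λ e → j≢k (inj (proj₁-inj e))) , ((j , refl) , ij) , ((k , refl) , ik)
  avoid : ∀ {d} → d ∈ D → Avoids G W d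
  avoid d∈D (i , refl) dom = x∈∁p⇒x∉p (proj₂ (c i)) (∈N[]ˢ G d∈D dom)

-- Walks cannot leave the closed triple, so connectedness makes it contain every vertex; positions
-- in the triple give the bijection.
closedTriangle⇒≅K3 : ∀ {n} (G : Graph (Fin n)) {a b c} → Connected G →
                     ClosedTriangle G ⊤ a b c → G ≅ K 3
closedTriangle⇒≅K3 {n} G {a} {b} {c} connected (_ , (ab , bc , ac) , closed) = record
  { bijection = mk↔ₛ′ index vertex (λ i → vertex-injective (vertex-index (vertex i))) vertex-index
  ; adjacency = λ u v → mk⇔
      (λ uv e → adj-irrefl G (subst (Adj G u) (sym (index-injective e)) uv))
      (λ i≢j → subst₂ (Adj G) (vertex-index u) (vertex-index v) (edge i≢j))
  }
  where
  reach : ∀ {u v} → u ∈ₗ triple G a b c → Star (Adj G) u v → v ∈ₗ triple G a b c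
  reach u∈ ε        = u∈
  reach u∈ (e ◅ es) = reach (closed _ u∈ _ ∈⊤ e) es

  vertex : Fin 3 → Fin n
  vertex = List.lookup (triple G a b c)

  index : Fin n → Fin 3
  index u = Any.index (reach (here refl) (connected a u))

  vertex-index : ∀ u → vertex (index u) ≡ u
  vertex-index u = sym (lookup-index (reach (here refl) (connected a u)))

  edge : ∀ {i j} → i ≢ j → Adj G (vertex i) (vertex j)
  edge {zero}           {zero}           i≢i = contradiction refl i≢i
  edge {zero}           {suc zero}       _   = ab
  edge {zero}           {suc (suc zero)} _   = ac
  edge {suc zero}       {zero}           _   = adj-sym G ab
  edge {suc zero}       {suc zero}       i≢i = contradiction refl i≢i
  edge {suc zero}       {suc (suc zero)} _   = bc
  edge {suc (suc zero)} {zero}           _   = adj-sym G ac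
  edge {suc (suc zero)} {suc zero}       _   = adj-sym G bc
  edge {suc (suc zero)} {suc (suc zero)} i≢i = contradiction refl i≢i

  vertex-injective : ∀ {i j} → vertex i ≡ vertex j → i ≡ j
  vertex-injective {i} {j} e =
    decidable-stable (i Fin.≟ j) λ i≢j → adj-irrefl G (subst (Adj G _) (sym e) (edge i≢j))

  index-injective : ∀ {u v} → index u ≡ index v → u ≡ v
  index-injective {u} {v} e =
    trans (sym (vertex-index u)) (trans (cong vertex e) (vertex-index v))

-- Excluding `K 3` lets the induction start at `⊤`: a connected graph with a triangle component is
-- that triangle.
4ιc≤n : ∀ {n} (G : Graph (Fin n)) → Connected G → ¬ G ≅ K 3 → 4 * ιc G ≤ n
4ιc≤n {n} G connected ¬K₃
  with isolatingBound G _ ⊤ (ℕ.n<1+n _) (λ t → ¬K₃ (closedTriangle⇒≅K3 G connected t))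
... | D , iso , le = ℕ.≤-trans
  (ℕ.*-monoʳ-≤ 4 (proj₂ (ιc-isMinimum G) _ (D , isolates⇒cycleIsolating G iso , refl)))
  (ℕ.≤-trans le (ℕ.≤-reflexive (∣⊤∣≡n n)))

ιc≤n/4 : ∀ {n} (G : Graph (Fin n)) → Connected G → ¬ G ≅ K 3 → ιc G ≤ n / 4
ιc≤n/4 {n} G connected ¬K₃ = ℕ.≤-trans
  (ℕ.≤-reflexive (sym (m*n/n≡m (ιc G) 4)))
  (/-monoˡ-≤ 4 (ℕ.≤-trans (ℕ.≤-reflexive (ℕ.*-comm (ιc G) 4)) (4ιc≤n G connected ¬K₃)))

-- Lower bound from triangles with disjoint closed neighbourhoods.

disjointTriangles≤ : ∀ {n a} (G : Graph (Fin n)) {D} (t : Fin a → Fin 3 → Fin n) (owner : Fin n → ℕ) →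
  (∀ i {p q} → p ≢ q → Adj G (t i p) (t i q)) →
  (∀ {d} i p → Dominates G d (t i p) → owner d ≡ toℕ i) →
  CycleIsolating G D → a ≤ ∣ D ∣
disjointTriangles≤ {n} {a} G {D} t owner edge own iso = begin
  a                                     ≡⟨ length-tabulate (proj₁ ∘ hit) ⟨
  length ds                             ≡⟨ ℕ.+-identityʳ _ ⟨
  length ds + 0                         ≡⟨ cong (λ k → length ds + k) (∣⊥∣≡0 n) ⟨
  length ds + ∣ ⊥ {n} ∣                 ≤⟨ length+∣S∣≤∣T∣ (tabulate⁺ hit-injective) (⊥⊆) ds∈ ⟩
  ∣ D ∣                                 ∎
  where
  open ℕ.≤-Reasoning

  -- If no vertex of `D` dominated any part of triangle `i`, the triangle would be a cycle (of
  -- length 3 + 0) outside `N[D]`.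
  hit : ∀ i → ∃ λ d → d ∈ D × ∃ λ p → Dominates G d (t i p)
  hit i = decidable-stable
    (any? λ d → (d ∈? D) ×-dec any? λ p → dominates? G d (t i p))
    λ ¬hit → iso
      ( 0
      , (λ p → t i p , x∉p⇒x∈∁p λ tp∈ →
           let d , d∈D , dom = ∈N[]ˢ⁻ G tp∈ in ¬hit (d , d∈D , p , dom))
      , (λ {p} {q} e → decidable-stable (p Fin.≟ q) λ p≢q →
           adj-irrefl G (subst (Adj G _) (sym (cong proj₁ e)) (edge i p≢q)))
      , (λ { zero → edge i λ () ; (suc zero) → edge i λ () })
      , edge i λ () )

  ds : List (Fin n)
  ds = List.tabulate (proj₁ ∘ hit)

  hit-owner : ∀ i → owner (proj₁ (hit i)) ≡ toℕ i
  hit-owner i = let _ , _ , p , dom = hit i in own i p dom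

  hit-injective : ∀ {i j} → proj₁ (hit i) ≡ proj₁ (hit j) → i ≡ j
  hit-injective {i} {j} e =
    Fin.toℕ-injective (trans (sym (hit-owner i)) (trans (cong owner e) (hit-owner j)))

  ds∈ : ∀ {u} → u ∈ₗ ds → u ∈ D × ¬ u ∈ ⊥
  ds∈ u∈ with ∈ₗ-tabulate⁻ u∈
  ... | i , refl = proj₁ (proj₂ (hit i)) , ∉⊥

-- Connectedness of `B n`.

rooted⇒connected : ∀ {V} (G : Graph V) r → (∀ v → Star (Adj G) v r) → Connected G
rooted⇒connected G r root u v = root u ◅◅ reverse (adj-sym G) (root v)

relabel-connected : ∀ {V W : Set} (f : W ↔ V) (G : Graph V) → Connected G → Connected (relabel f G)
relabel-connected f G connected u v = subst₂ (Star _) (strictlyInverseʳ u) (strictlyInverseʳ v)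
  (gmap from (λ {x} {y} → subst₂ (Adj G) (sym (strictlyInverseˡ x)) (sym (strictlyInverseˡ y)))
    (connected (to u) (to v)))
  where open Inverse f

P-connected : ∀ n → Connected (P n)
P-connected (suc n) = rooted⇒connected (P (suc n)) zero
  (<-weakInduction _ ε λ i path → inj₂ (cong suc (Fin.toℕ-inject₁ i)) ◅ path)

withTriangles-connected : ∀ a b → 1 ≤ a → a ≤ b → Connected (withTriangles a b)
withTriangles-connected (suc a) (suc b) _ a<b = rooted⇒connected G (inj₁ zero) root
  where
  G = withTriangles (suc a) (suc b)
  hub : ∀ i → toℕ i < suc a → Star (Adj G) (inj₁ i) (inj₁ zero)
  hub = <-weakInduction _ (λ _ → ε) λ i path i<a →
    inj₂ (inj₁ (cong suc (Fin.toℕ-inject₁ i) , i<a))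
      ◅ path (ℕ.<-trans (ℕ.≤-reflexive (cong suc (Fin.toℕ-inject₁ i))) i<a)
  path* : ∀ i → Star (Adj G) (inj₁ i) (inj₁ zero)
  path* i with toℕ i ℕ.<? suc a
  ... | yes i<a = hub i i<a
  -- Pendant vertices hang off the last path vertex, which is `fromℕ< a<b`.
  ... | no  i≮a = inj₂ (inj₂ (cong suc (Fin.toℕ-fromℕ< a<b) , ℕ.≮⇒≥ i≮a))
                  ◅ hub (fromℕ< a<b) (ℕ.≤-reflexive (cong suc (Fin.toℕ-fromℕ< a<b)))
  root : ∀ v → Star (Adj G) v (inj₁ zero)
  root (inj₁ i)       = path* i
  root (inj₂ (i , p)) = Fin.toℕ-inject≤ i a<b ◅ path* (inject≤ i a<b)

n/4≤n∸3[n/4] : ∀ n → n / 4 ≤ n ∸ 3 * (n / 4)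
n/4≤n∸3[n/4] n = ℕ.m+n≤o⇒m≤o∸n (n / 4)
  (ℕ.≤-trans (ℕ.≤-reflexive (ℕ.*-comm 4 (n / 4))) (m/n*n≤m n 4))

B-connected : ∀ n → Connected (B n)
-- `if-elim` gives each branch of `B n` its condition; once `n ≤ 3` fails, `n / 4` is positive and a
-- root exists.
B-connected n = if-elim Connected (does (n ≤? 3)) (λ _ → P-connected n) λ n≰3 →
  relabel-connected (B-vertices n) (withTriangles (n / 4) (n ∸ 3 * (n / 4)))
    (withTriangles-connected (n / 4) _ (m≥n⇒m/n>0 (ℕ.≰⇒> (does-false (n ≤? 3) n≰3))) (n/4≤n∸3[n/4] n))

-- The isolation number of `B n`.

B≇K3 : ∀ n → ¬ B n ≅ K 3
B≇K3 n iso with ↔⇒≡ (_≅_.bijection iso)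
-- The orders force `n` to be 3, and the two ends of `P 3` are distinct but not adjacent.
... | refl with Equivalence.from (_≅_.adjacency iso zero (suc (suc zero)))
                  (λ e → Fin.0≢1+n (Injection.injective (↔⇒↣ (_≅_.bijection iso)) e))
...   | inj₁ ()
...   | inj₂ ()

withTriangles-isolating : ∀ {n a b} (f : Fin n ↔ (Fin b ⊎ (Fin a × Fin 3))) {D} →
                          CycleIsolating (relabel f (withTriangles a b)) D → a ≤ ∣ D ∣
withTriangles-isolating {n} {a} {b} f = disjointTriangles≤ (relabel f H) triangle owner edge own
  where
  H = withTriangles a b
  open Inverse f using (to; from; strictlyInverseˡ; strictlyInverseʳ)

  triangle : Fin (a) → Fin 3 → Fin n
  triangle i p = from (inj₂ (i , p))

  -- Vertex `i` of the path and all of triangle `i` get the number `i`, so the closed neighbourhoods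
  -- of different triangles are told apart.
  owner : Fin n → ℕ
  owner d = [ toℕ , toℕ ∘ proj₁ ]′ (to d)

  edge : ∀ i {p q} → p ≢ q → Adj (relabel f H) (triangle i p) (triangle i q)
  edge i p≢q = subst₂ (Adj H) (sym (strictlyInverseˡ _)) (sym (strictlyInverseˡ _)) (refl , p≢q)

  owner-adj : ∀ x {i p} → Adj H x (inj₂ (i , p)) → [ toℕ , toℕ ∘ proj₁ ]′ x ≡ toℕ i
  owner-adj (inj₁ x) e           = e
  owner-adj (inj₂ _) (refl , _)  = refl

  own : ∀ {d} i p → Dominates (relabel f H) d (triangle i p) → owner d ≡ toℕ i
  own i p (inj₁ refl) = cong [ toℕ , toℕ ∘ proj₁ ]′ (strictlyInverseˡ (inj₂ (i , p)))
  own {d} i p (inj₂ e) = owner-adj (to d) (subst (Adj H (to d)) (strictlyInverseˡ _) e)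

B-isolating : ∀ n {D} → CycleIsolating (B n) D → n / 4 ≤ ∣ D ∣
B-isolating n {D} = if-elim (λ G → CycleIsolating G D → n / 4 ≤ ∣ D ∣) (does (n ≤? 3))
  (λ n≤3 _ → ℕ.≤-trans (ℕ.≤-reflexive (m<n⇒m/n≡0 (s≤s (does-true (n ≤? 3) n≤3)))) z≤n)
  (λ _ → withTriangles-isolating (B-vertices n))

ιc[B]≡n/4 : ∀ n → ιc (B n) ≡ n / 4
ιc[B]≡n/4 n = ℕ.≤-antisym (ιc≤n/4 (B n) (B-connected n) (B≇K3 n))
  (let D , iso , ∣D∣≡ιc = proj₁ (ιc-isMinimum (B n))
   in subst (n / 4 ≤_) ∣D∣≡ιc (B-isolating n {D} iso))

theorem1p1 : (∀ n (G : Graph (Fin n)) → Connected G → ¬ (G ≅ K 3) →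
    (+ ιc G) ℚᵘ./ 1 ℚᵘ.≤ (+ n) ℚᵘ./ 4)
    × (∀ n → n ≥ 1 → IsMaxιc n (ιc (B n)) × ιc (B n) ≡ n / 4)
theorem1p1 =
  -- The rational inequality means, after cross-multiplication, `ιc G * 4 ≤ n * 1` over the
  -- integers.
  (λ n G connected ¬K₃ → ℚᵘ.*≤* (subst₂ ℤ._≤_
    (ℤ.pos-* (ιc G) 4) (ℤ.pos-* n 1)
    (ℤ.+≤+ (subst₂ _≤_ (ℕ.*-comm 4 (ιc G)) (sym (ℕ.*-identityʳ n)) (4ιc≤n G connected ¬K₃))))) ,
  λ n _ →
    ( (B n , B-connected n , B≇K3 n , refl)
    , (λ { _ (G , connected , ¬K₃ , refl) → ℕ.≤-trans (ιc≤n/4 G connected ¬K₃)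
             (ℕ.≤-reflexive (sym (ιc[B]≡n/4 n))) }) )
    , ιc[B]≡n/4 n
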